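{- Let $G$ be a finite simple undirected graph with at least one vertex. Then $$\dim_{EHT}(G)\le 2\,(\dim(G)+1)\cdot \lfloor\log_2(|G|)\rfloor,$$ where $\dim_{EHT}(G)$ and $\dim(G)$ are the two notions of dimension of a graph defined in the context.
   Context: All graphs are finite, simple and undirected; $|G|$ denotes the number of vertices of a graph $G$. For a graph $H$, let $\delta(H)=\max_{x\in V(H)}\deg_H(x)$ denote its maximum degree. For a nonempty graph $G'$ define its sub-dimension $$\mathrm{subdim}(G')=\min_{G''}\ \delta(G''),$$ where the minimum is over all induced subgraphs $G''=(V'',E'')$ of $G'$ (i.e. $E''$ consists of all edges of $G'$ with both endpoints in $V''$) with $|V''|\ge \lfloor |G'|/2\rfloor+1$. The dimension of a nonempty graph $G$ is $$\dim(G)=\max_{G'}\ \mathrm{subdim}(G'),$$ where the maximum is over all induced subgraphs $G'$ of $G$ on a nonempty vertex set. The Erdős–Harary–Tutte dimension $\dim_{EHT}(G)$ is the least integer $d\ge 0$ such that there is an injective map $f:V(G)\to\mathbb{R}^d$ with $\|f(x)-f(y)\|=1$ (Euclidean norm) for every edge $xy$ of $G$ (edges are allowed to cross, and non-adjacent vertices may also be at distance 1). -}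

module Defs where

open import Data.Bool.Base using (true; false)
open import Data.Empty using (⊥-elim)
open import Data.Fin.Base using (Fin; zero; suc)
open import Data.Fin.Subset using (Subset; inside; outside; _∩_; ∣_∣; Nonempty)
open import Data.Fin.Subset.Properties using (_∈?_; _⊆?_; nonempty?)
open import Data.List.Base as List using (List; []; _∷_; _++_; allFin; filter)
open import Data.List.Extrema.Nat using (max; min)
open import Data.List.Membership.Propositional using () renaming (_∈_ to _∈ˡ_)
open import Data.List.Membership.Propositional.Properties using (∈-++⁺ˡ; ∈-++⁺ʳ; ∈-map⁺)
open import Data.List.Relation.Unary.Any using (here)
open import Data.Nat.Base as ℕ using (ℕ; zero; suc; ⌊_/2⌋)
import Data.Nat.Properties as ℕ
open import Data.Nat.Induction using (<-rec)
open import Data.Product.Base using (_×_; _,_; proj₁; proj₂; ∃-syntax)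
open import Data.Rational.Base as ℚ using (ℚ; 0ℚ; 1ℚ; ½; 1/_)
import Data.Rational.Properties as ℚ
open import Data.Rational.Solver using (module +-*-Solver)
open import Data.Vec.Base as Vec using ([]; _∷_)
open import Data.Vec.Functional using (Vector; foldr)
open import Function.Base using (_∘_)
open import Function.Definitions using (Injective)
open import Level using (0ℓ)
open import Relation.Binary.Core using (Rel)
open import Relation.Binary.Definitions using (Decidable; Symmetric; Irreflexive)
open import Relation.Binary.PropositionalEquality
  using (_≡_; refl; sym; trans; cong; cong₂; subst)
open import Relation.Nullary.Decidable.Core using (does; _×-dec_)
open import Relation.Nullary.Negation.Core using (¬_)

-- Decidability of adjacency is automatic in classical mathematics.
record Graph : Set₁ where
  field
    order  : ℕ
    Adj    : Rel (Fin order) 0ℓ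
    adj?   : Decidable Adj
    symm   : Symmetric Adj
    irrefl : Irreflexive _≡_ Adj

open Graph public using (order)

allSubsets : ∀ n → List (Subset n)
allSubsets zero    = [] ∷ []
allSubsets (suc n) =
  List.map (outside ∷_) (allSubsets n) ++ List.map (inside ∷_) (allSubsets n)

allSubsets-complete : ∀ {n} (S : Subset n) → S ∈ˡ allSubsets n
allSubsets-complete []          = here refl
allSubsets-complete (false ∷ S) =
  ∈-++⁺ˡ (∈-map⁺ (outside ∷_) (allSubsets-complete S))
allSubsets-complete (true ∷ S)  =
  ∈-++⁺ʳ (List.map (outside ∷_) (allSubsets _))
         (∈-map⁺ (inside ∷_) (allSubsets-complete S))

-- An induced subgraph of G is represented by its vertex set S; an induced
-- subgraph of an induced subgraph is then a subset T ⊆ S.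
module _ (G : Graph) where
  open Graph G using (Adj; adj?)

  private
    V : Set
    V = Fin (order G)

  neighbours : V → Subset (order G)
  neighbours x = Vec.tabulate (λ y → does (adj? x y))

  degree : Subset (order G) → V → ℕ
  degree S x = ∣ S ∩ neighbours x ∣

  maxDegree : Subset (order G) → ℕ
  maxDegree S = max 0 (List.map (degree S) (filter (_∈? S) (allFin (order G))))

  largeSubsets : Subset (order G) → List (Subset (order G))
  largeSubsets S =
    filter (λ T → (T ⊆? S) ×-dec (⌊ ∣ S ∣ /2⌋ ℕ.+ 1 ℕ.≤? ∣ T ∣))
           (allSubsets (order G))

  -- The first argument of `min` is harmless: for nonempty S, the set S
  -- itself belongs to largeSubsets S.
  subdim : Subset (order G) → ℕ
  subdim S = min (maxDegree S) (List.map maxDegree (largeSubsets S))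

  dim : ℕ
  dim = max 0 (List.map subdim (filter nonempty? (allSubsets (order G))))

-- Real numbers are Cauchy sequences of rationals, equal when their
-- difference is a null sequence.
Cauchy : (ℕ → ℚ) → Set
Cauchy x = ∀ ε → 0ℚ ℚ.< ε →
  ∃[ N ] (∀ m n → N ℕ.≤ m → N ℕ.≤ n → ℚ.∣ x m ℚ.- x n ∣ ℚ.< ε)

record ℝ : Set where
  constructor mkℝ
  field
    seq    : ℕ → ℚ
    cauchy : Cauchy seq

open ℝ public

infix  4 _≃_ _≤ᴿ_ _≋_
infixl 6 _+ᴿ_ _-ᴿ_
infixl 7 _*ᴿ_
infix  8 -ᴿ_

_≃_ : Rel ℝ 0ℓ
x ≃ y = ∀ ε → 0ℚ ℚ.< ε →
  ∃[ N ] (∀ n → N ℕ.≤ n → ℚ.∣ seq x n ℚ.- seq y n ∣ ℚ.< ε)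

_≤ᴿ_ : Rel ℝ 0ℓ
x ≤ᴿ y = ∀ ε → 0ℚ ℚ.< ε →
  ∃[ N ] (∀ n → N ℕ.≤ n → seq x n ℚ.< seq y n ℚ.+ ε)

private
  ½*-pos : ∀ ε → 0ℚ ℚ.< ε → 0ℚ ℚ.< ½ ℚ.* ε
  ½*-pos ε 0<ε = subst (ℚ._< ½ ℚ.* ε) (ℚ.*-zeroʳ ½) (ℚ.*-monoʳ-<-pos ½ 0<ε)

  halves : ∀ ε → ½ ℚ.* ε ℚ.+ ½ ℚ.* ε ≡ ε
  halves ε = trans (sym (ℚ.*-distribʳ-+ ε ½ ½))
             (trans (cong (ℚ._* ε) ½+½≡1) (ℚ.*-identityˡ ε))
    where
    ½+½≡1 : ½ ℚ.+ ½ ≡ 1ℚ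
    ½+½≡1 = refl

  ∣p-p∣≡0 : ∀ p → ℚ.∣ p ℚ.- p ∣ ≡ 0ℚ
  ∣p-p∣≡0 p = cong ℚ.∣_∣ (ℚ.+-inverseʳ p)

  +-diff : ∀ a b c d → (a ℚ.+ b) ℚ.- (c ℚ.+ d) ≡ (a ℚ.- c) ℚ.+ (b ℚ.- d)
  +-diff = solve 4 (λ a b c d → (a :+ b) :- (c :+ d) := (a :- c) :+ (b :- d)) refl
    where open +-*-Solver

  neg-diff : ∀ a b → (ℚ.- a) ℚ.- (ℚ.- b) ≡ ℚ.- (a ℚ.- b)
  neg-diff = solve 2 (λ a b → (:- a) :- (:- b) := :- (a :- b)) refl
    where open +-*-Solver

  *-diff : ∀ a b c d →
    (a ℚ.* b) ℚ.- (c ℚ.* d) ≡ a ℚ.* (b ℚ.- d) ℚ.+ d ℚ.* (a ℚ.- c)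
  *-diff = solve 4 (λ a b c d →
    (a :* b) :- (c :* d) := a :* (b :- d) :+ d :* (a :- c)) refl
    where open +-*-Solver

  a≡a-b+b : ∀ a b → a ≡ (a ℚ.- b) ℚ.+ b
  a≡a-b+b = solve 2 (λ a b → a := (a :- b) :+ b) refl
    where open +-*-Solver

  Bound : (ℕ → ℚ) → Set
  Bound x = ∃[ K ] (0ℚ ℚ.< K × ∃[ N ] (∀ m → N ℕ.≤ m → ℚ.∣ x m ∣ ℚ.< K))

  bounded : ∀ x → Cauchy x → Bound x
  bounded x c with c 1ℚ (ℚ.positive⁻¹ 1ℚ)
  ... | N , h = 1ℚ ℚ.+ ℚ.∣ x N ∣
              , ℚ.+-mono-<-≤ (ℚ.positive⁻¹ 1ℚ) (ℚ.0≤∣p∣ (x N))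
              , N , λ m N≤m → begin-strict
      ℚ.∣ x m ∣                         ≡⟨ cong ℚ.∣_∣ (a≡a-b+b (x m) (x N)) ⟩
      ℚ.∣ (x m ℚ.- x N) ℚ.+ x N ∣       ≤⟨ ℚ.∣p+q∣≤∣p∣+∣q∣ (x m ℚ.- x N) (x N) ⟩
      ℚ.∣ x m ℚ.- x N ∣ ℚ.+ ℚ.∣ x N ∣   <⟨ ℚ.+-monoˡ-< ℚ.∣ x N ∣ (h m N N≤m ℕ.≤-refl) ⟩
      1ℚ ℚ.+ ℚ.∣ x N ∣                  ∎
    where open ℚ.≤-Reasoning

  Shrink : ℚ → ℚ → Set
  Shrink K ε = ∃[ η ] (0ℚ ℚ.< η ×
    (∀ a b → ℚ.∣ a ∣ ℚ.< K → ℚ.∣ b ∣ ℚ.< η → ℚ.∣ a ℚ.* b ∣ ℚ.< ε))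

  shrink : ∀ K → 0ℚ ℚ.< K → ∀ ε → 0ℚ ℚ.< ε → Shrink K ε
  shrink K 0<K ε 0<ε = η , 0<η , λ a b a<K b<η → begin-strict
      ℚ.∣ a ℚ.* b ∣         ≡⟨ ℚ.∣p*q∣≡∣p∣*∣q∣ a b ⟩
      ℚ.∣ a ∣ ℚ.* ℚ.∣ b ∣   ≤⟨ ℚ.*-monoʳ-≤-nonNeg ℚ.∣ b ∣ {{ℚ.∣-∣-nonNeg b}} (ℚ.<⇒≤ a<K) ⟩
      K ℚ.* ℚ.∣ b ∣         <⟨ ℚ.*-monoʳ-<-pos K b<η ⟩
      K ℚ.* (1/ K ℚ.* ε)    ≡⟨ sym (ℚ.*-assoc K (1/ K) ε) ⟩
      (K ℚ.* 1/ K) ℚ.* ε    ≡⟨ cong (ℚ._* ε) (ℚ.*-inverseʳ K) ⟩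
      1ℚ ℚ.* ε              ≡⟨ ℚ.*-identityˡ ε ⟩
      ε                     ∎
    where
    open ℚ.≤-Reasoning
    instance
      K-pos : ℚ.Positive K
      K-pos = ℚ.positive 0<K
      K-nonZero : ℚ.NonZero K
      K-nonZero = ℚ.pos⇒nonZero K
      1/K-pos : ℚ.Positive (1/ K)
      1/K-pos = ℚ.1/pos⇒pos K
    η = 1/ K ℚ.* ε
    0<η : 0ℚ ℚ.< η
    0<η = subst (ℚ._< η) (ℚ.*-zeroʳ (1/ K)) (ℚ.*-monoʳ-<-pos (1/ K) 0<ε)

  sum-small : ∀ ε p q → ℚ.∣ p ∣ ℚ.< ½ ℚ.* ε → ℚ.∣ q ∣ ℚ.< ½ ℚ.* ε →
    ℚ.∣ p ℚ.+ q ∣ ℚ.< ε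
  sum-small ε p q p< q< = begin-strict
      ℚ.∣ p ℚ.+ q ∣           ≤⟨ ℚ.∣p+q∣≤∣p∣+∣q∣ p q ⟩
      ℚ.∣ p ∣ ℚ.+ ℚ.∣ q ∣     <⟨ ℚ.+-mono-< p< q< ⟩
      ½ ℚ.* ε ℚ.+ ½ ℚ.* ε     ≡⟨ halves ε ⟩
      ε                       ∎
    where open ℚ.≤-Reasoning

  +-cauchy′ : ∀ x y → Cauchy x → Cauchy y → Cauchy (λ n → x n ℚ.+ y n)
  +-cauchy′ x y cx cy ε 0<ε with cx (½ ℚ.* ε) (½*-pos ε 0<ε) | cy (½ ℚ.* ε) (½*-pos ε 0<ε)
  ... | M , hx | N , hy = M ℕ.⊔ N , λ m n Lm Ln →
    subst (λ z → ℚ.∣ z ∣ ℚ.< ε) (sym (+-diff (x m) (y m) (x n) (y n)))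
      (sum-small ε (x m ℚ.- x n) (y m ℚ.- y n)
        (hx m n (ℕ.m⊔n≤o⇒m≤o M N Lm) (ℕ.m⊔n≤o⇒m≤o M N Ln))
        (hy m n (ℕ.m⊔n≤o⇒n≤o M N Lm) (ℕ.m⊔n≤o⇒n≤o M N Ln)))

  neg-cauchy′ : ∀ x → Cauchy x → Cauchy (λ n → ℚ.- x n)
  neg-cauchy′ x cx ε 0<ε with cx ε 0<ε
  ... | N , h = N , λ m n Lm Ln →
    subst (ℚ._< ε)
      (sym (trans (cong ℚ.∣_∣ (neg-diff (x m) (x n))) (ℚ.∣-p∣≡∣p∣ (x m ℚ.- x n))))
      (h m n Lm Ln)

  *-cauchy′ : ∀ x y → Cauchy x → Cauchy y → Cauchy (λ n → x n ℚ.* y n)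
  *-cauchy′ x y cx cy ε 0<ε = go (bounded x cx) (bounded y cy)
    where
    Goal : Set
    Goal = ∃[ N ] (∀ m n → N ℕ.≤ m → N ℕ.≤ n → ℚ.∣ x m ℚ.* y m ℚ.- x n ℚ.* y n ∣ ℚ.< ε)

    go : Bound x → Bound y → Goal
    go (K , 0<K , A , x<K) (L , 0<L , B , y<L) =
      go′ (shrink K 0<K (½ ℚ.* ε) (½*-pos ε 0<ε)) (shrink L 0<L (½ ℚ.* ε) (½*-pos ε 0<ε))
      where
      go′ : Shrink K (½ ℚ.* ε) → Shrink L (½ ℚ.* ε) → Goal
      go′ (η , 0<η , small-x) (θ , 0<θ , small-y) = N , λ m n N≤m N≤n →
        subst (λ z → ℚ.∣ z ∣ ℚ.< ε) (sym (*-diff (x m) (y m) (x n) (y n)))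
          (sum-small ε (x m ℚ.* (y m ℚ.- y n)) (y n ℚ.* (x m ℚ.- x n))
            (small-x (x m) (y m ℚ.- y n)
              (x<K m (A≤ m N≤m)) (proj₂ (cy η 0<η) m n (C≤ m N≤m) (C≤ n N≤n)))
            (small-y (y n) (x m ℚ.- x n)
              (y<L n (B≤ n N≤n)) (proj₂ (cx θ 0<θ) m n (D≤ m N≤m) (D≤ n N≤n))))
        where
        C = proj₁ (cy η 0<η)
        D = proj₁ (cx θ 0<θ)
        N = (A ℕ.⊔ B) ℕ.⊔ (C ℕ.⊔ D)
        A≤ : ∀ k → N ℕ.≤ k → A ℕ.≤ k
        A≤ k p = ℕ.m⊔n≤o⇒m≤o A B (ℕ.m⊔n≤o⇒m≤o (A ℕ.⊔ B) (C ℕ.⊔ D) p)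
        B≤ : ∀ k → N ℕ.≤ k → B ℕ.≤ k
        B≤ k p = ℕ.m⊔n≤o⇒n≤o A B (ℕ.m⊔n≤o⇒m≤o (A ℕ.⊔ B) (C ℕ.⊔ D) p)
        C≤ : ∀ k → N ℕ.≤ k → C ℕ.≤ k
        C≤ k p = ℕ.m⊔n≤o⇒m≤o C D (ℕ.m⊔n≤o⇒n≤o (A ℕ.⊔ B) (C ℕ.⊔ D) p)
        D≤ : ∀ k → N ℕ.≤ k → D ℕ.≤ k
        D≤ k p = ℕ.m⊔n≤o⇒n≤o C D (ℕ.m⊔n≤o⇒n≤o (A ℕ.⊔ B) (C ℕ.⊔ D) p)

  const-cauchy′ : ∀ q → Cauchy (λ _ → q)
  const-cauchy′ q ε 0<ε = 0 , λ _ _ _ _ → subst (ℚ._< ε) (sym (∣p-p∣≡0 q)) 0<ε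

  -- Opaque copies, so that the type checker never unfolds these proofs when
  -- it compares two real numbers.
  abstract
    +-cauchy : ∀ x y → Cauchy x → Cauchy y → Cauchy (λ n → x n ℚ.+ y n)
    +-cauchy = +-cauchy′

    neg-cauchy : ∀ x → Cauchy x → Cauchy (λ n → ℚ.- x n)
    neg-cauchy = neg-cauchy′

    *-cauchy : ∀ x y → Cauchy x → Cauchy y → Cauchy (λ n → x n ℚ.* y n)
    *-cauchy = *-cauchy′

    const-cauchy : ∀ q → Cauchy (λ _ → q)
    const-cauchy = const-cauchy′

fromℚ : ℚ → ℝ
fromℚ q = mkℝ (λ _ → q) (const-cauchy q)

0ᴿ 1ᴿ : ℝ
0ᴿ = fromℚ 0ℚ
1ᴿ = fromℚ 1ℚ

_+ᴿ_ _*ᴿ_ : ℝ → ℝ → ℝ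
mkℝ x cx +ᴿ mkℝ y cy = mkℝ (λ n → x n ℚ.+ y n) (+-cauchy x y cx cy)
mkℝ x cx *ᴿ mkℝ y cy = mkℝ (λ n → x n ℚ.* y n) (*-cauchy x y cx cy)

-ᴿ_ : ℝ → ℝ
-ᴿ mkℝ x cx = mkℝ (λ n → ℚ.- x n) (neg-cauchy x cx)

_-ᴿ_ : ℝ → ℝ → ℝ
x -ᴿ y = x +ᴿ (-ᴿ y)

_≋_ : ∀ {d} → Rel (Vector ℝ d) 0ℓ
u ≋ v = ∀ i → u i ≃ v i

∑ : ∀ {d} → Vector ℝ d → ℝ
∑ = foldr _+ᴿ_ 0ᴿ

_⊖_ : ∀ {d} → Vector ℝ d → Vector ℝ d → Vector ℝ d
(u ⊖ v) i = u i -ᴿ v i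

-- r = √s, the nonnegative real whose square is s.
IsSqrt : ℝ → ℝ → Set
IsSqrt s r = 0ᴿ ≤ᴿ r × (r *ᴿ r) ≃ s

-- The graph of the Euclidean norm: ‖ v ‖≃ r says √(v₁² + … + v_d²) = r.
‖_‖≃_ : ∀ {d} → Vector ℝ d → ℝ → Set
‖ v ‖≃ r = IsSqrt (∑ (λ i → v i *ᴿ v i)) r

module _ (G : Graph) where
  open Graph G using (Adj; irrefl)

  IsUnitDistance : ∀ {d} → (Fin (order G) → Vector ℝ d) → Set
  IsUnitDistance f = ∀ {x y} → Adj x y → ‖ f x ⊖ f y ‖≃ 1ᴿ

  Embeds : ℕ → Set
  Embeds d = ∃[ f ] (Injective _≡_ (_≋_ {d}) f × IsUnitDistance f)

  -- `IsDimEHT G d` says that d is the least element of `Embeds G`.  It is a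
  -- relation because finding the least element requires deciding `Embeds G`.
  -- It determines d (dimEHT-unique) and, classically, such a d always
  -- exists (dimEHT-exists).
  IsDimEHT : ℕ → Set
  IsDimEHT d = Embeds d × (∀ {d′} → Embeds d′ → d ℕ.≤ d′)

  dimEHT-unique : ∀ {d e} → IsDimEHT d → IsDimEHT e → d ≡ e
  dimEHT-unique (p , p-least) (q , q-least) = ℕ.≤-antisym (p-least q) (q-least p)

private
  sumℚ : ∀ {d} → Vector ℚ d → ℚ
  sumℚ = foldr ℚ._+_ 0ℚ

  distSq : ∀ {d} → Vector ℚ d → Vector ℚ d → ℚ
  distSq u v = sumℚ (λ i → (u i ℚ.- v i) ℚ.* (u i ℚ.- v i))

  -- Vertex i goes to (½ , ½) in the i-th of n coordinate planes.
  simplex : ∀ n → Fin n → Vector ℚ (n ℕ.* 2)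
  simplex (suc n) zero    zero          = ½
  simplex (suc n) zero    (suc zero)    = ½
  simplex (suc n) zero    (suc (suc k)) = 0ℚ
  simplex (suc n) (suc i) zero          = 0ℚ
  simplex (suc n) (suc i) (suc zero)    = 0ℚ
  simplex (suc n) (suc i) (suc (suc k)) = simplex n i k

  0⃗ : ∀ {d} → Vector ℚ d
  0⃗ _ = 0ℚ

  distSq-refl : ∀ {d} (u : Vector ℚ d) → distSq u u ≡ 0ℚ
  distSq-refl {zero}  u = refl
  distSq-refl {suc d} u =
    cong₂ ℚ._+_ (cong (λ z → z ℚ.* z) (ℚ.+-inverseʳ (u zero))) (distSq-refl (u ∘ suc))

  distSq-sym : ∀ {d} (u v : Vector ℚ d) → distSq u v ≡ distSq v u
  distSq-sym {zero}  u v = refl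
  distSq-sym {suc d} u v =
    cong₂ ℚ._+_ (lemma (u zero) (v zero)) (distSq-sym (u ∘ suc) (v ∘ suc))
    where
    open +-*-Solver
    lemma : ∀ a b → (a ℚ.- b) ℚ.* (a ℚ.- b) ≡ (b ℚ.- a) ℚ.* (b ℚ.- a)
    lemma = solve 2 (λ a b → (a :- b) :* (a :- b) := (b :- a) :* (b :- a)) refl

  skip : ∀ z → 0ℚ ℚ.+ (0ℚ ℚ.+ z) ≡ z
  skip z = trans (ℚ.+-identityˡ (0ℚ ℚ.+ z)) (ℚ.+-identityˡ z)

  ¼ : ℚ
  ¼ = ½ ℚ.* ½

  simplex-norm : ∀ n i → distSq 0⃗ (simplex n i) ≡ ½
  simplex-norm (suc n) zero    =
    cong (λ z → ¼ ℚ.+ (¼ ℚ.+ z)) (distSq-refl {n ℕ.* 2} 0⃗)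
  simplex-norm (suc n) (suc i) = trans (skip _) (simplex-norm n i)

  simplex-dist : ∀ n {i j} → ¬ i ≡ j → distSq (simplex n i) (simplex n j) ≡ 1ℚ
  simplex-dist (suc n) {zero}  {zero}  i≢j = ⊥-elim (i≢j refl)
  simplex-dist (suc n) {zero}  {suc j} i≢j =
    cong (λ z → ¼ ℚ.+ (¼ ℚ.+ z)) (simplex-norm n j)
  simplex-dist (suc n) {suc i} {zero}  i≢j =
    cong (λ z → ¼ ℚ.+ (¼ ℚ.+ z))
      (trans (distSq-sym (simplex n i) 0⃗) (simplex-norm n i))
  simplex-dist (suc n) {suc i} {suc j} i≢j =
    trans (skip _) (simplex-dist n (i≢j ∘ cong suc))

  ≡⇒≃ : ∀ x y → (∀ n → seq x n ≡ seq y n) → x ≃ y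
  ≡⇒≃ x y eq ε 0<ε = 0 , λ n _ →
    subst (λ z → ℚ.∣ z ℚ.- seq y n ∣ ℚ.< ε) (sym (eq n))
      (subst (ℚ._< ε) (sym (∣p-p∣≡0 (seq y n))) 0<ε)

  fromℚ-injective : ∀ p q → fromℚ p ≃ fromℚ q → ¬ ¬ p ≡ q
  fromℚ-injective p q p≃q p≢q = ℚ.<-irrefl {δ} {δ} refl (proj₂ (p≃q δ 0<δ) _ ℕ.≤-refl)
    where
    δ = ℚ.∣ p ℚ.- q ∣
    δ≡0⇒p≡q : p ℚ.- q ≡ 0ℚ → p ≡ q
    δ≡0⇒p≡q eq = trans (a≡a-b+b p q) (trans (cong (ℚ._+ q) eq) (ℚ.+-identityˡ q))
    0<δ : 0ℚ ℚ.< δ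
    0<δ = ℚ.≰⇒> λ δ≤0 →
      p≢q (δ≡0⇒p≡q (ℚ.∣p∣≡0⇒p≡0 (p ℚ.- q) (ℚ.≤-antisym δ≤0 (ℚ.0≤∣p∣ (p ℚ.- q)))))

  seq-∑ : ∀ {d} (u v : Vector ℚ d) n →
    seq (∑ (λ i → (fromℚ (u i) -ᴿ fromℚ (v i)) *ᴿ (fromℚ (u i) -ᴿ fromℚ (v i)))) n
      ≡ distSq u v
  seq-∑ {zero}  u v n = refl
  seq-∑ {suc d} u v n =
    cong ((u zero ℚ.- v zero) ℚ.* (u zero ℚ.- v zero) ℚ.+_) (seq-∑ (u ∘ suc) (v ∘ suc) n)

  simplex-injective : ∀ n {i j} →
    (∀ k → fromℚ (simplex n i k) ≃ fromℚ (simplex n j k)) → i ≡ j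
  simplex-injective (suc n) {zero}  {zero}  h = refl
  simplex-injective (suc n) {zero}  {suc j} h = ⊥-elim (fromℚ-injective ½ 0ℚ (h zero) (λ ()))
  simplex-injective (suc n) {suc i} {zero}  h = ⊥-elim (fromℚ-injective 0ℚ ½ (h zero) (λ ()))
  simplex-injective (suc n) {suc i} {suc j} h =
    cong suc (simplex-injective n (λ k → h (suc (suc k))))

  least : (P : ℕ → Set) → ∀ n → P n →
    ¬ ¬ (∃[ m ] (P m × (∀ {k} → P k → m ℕ.≤ k)))
  least P n pn none = <-rec (λ m → ¬ P m)
    (λ m below pm → none (m , pm , λ {k} pk → ℕ.≮⇒≥ λ k<m → below k<m pk)) n pn

private
  0≤1 : 0ᴿ ≤ᴿ 1ᴿ
  0≤1 ε 0<ε = 0 , λ _ _ → ℚ.+-mono-< {0ℚ} {1ℚ} {0ℚ} {ε} (ℚ.positive⁻¹ 1ℚ) 0<ε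

  unit-dist : ∀ {d} (u v : Vector ℚ d) → distSq u v ≡ 1ℚ →
    ‖ (λ k → fromℚ (u k)) ⊖ (λ k → fromℚ (v k)) ‖≃ 1ᴿ
  unit-dist u v eq = 0≤1 , ≡⇒≃ (1ᴿ *ᴿ 1ᴿ)
    (∑ (λ i → (fromℚ (u i) -ᴿ fromℚ (v i)) *ᴿ (fromℚ (u i) -ᴿ fromℚ (v i))))
    (λ n → sym (trans (seq-∑ u v n) eq))

embeds-2n : ∀ G → Embeds G (order G ℕ.* 2)
embeds-2n G = (λ x k → fromℚ (simplex n x k)) , simplex-injective n , λ {x} {y} xy →
    unit-dist (simplex n x) (simplex n y)
      (simplex-dist n λ x≡y → Graph.irrefl G x≡y xy)
  where
  n : ℕ
  n = order G

dimEHT-exists : ∀ G → ¬ ¬ (∃[ d ] IsDimEHT G d)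
dimEHT-exists G = least (Embeds G) (order G ℕ.* 2) (embeds-2n G)

{-# OPTIONS --safe #-}

-- Repeatedly remove from the vertex set a subset T containing more than half of
-- the remaining vertices and inducing maximum degree at most D = dim G.
-- Each T is properly coloured with D + 1 colours, and each colour is realised
-- by the circle of radius 1/√2 in a coordinate plane of its own, so that points
-- on different circles are at distance 1.  To get ⌊log₂ |G|⌋ rounds instead of
-- one more, stop when at most three vertices are left: these fit on the D + 1
-- planes of a single round, because a circle also carries two points at
-- distance 1, namely orthogonal ones.  This needs D ≥ 1, but a graph of
-- dimension 0 has no edges and fits on one circle.

module Submission where

open import Defs
open import Data.Bool.Base using (true; false)
open import Data.Fin.Base using (Fin; zero; suc; toℕ; _↑ˡ_; _↑ʳ_; splitAt)
import Data.Fin.Properties as Fin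
open import Data.Fin.Subset
  using (Subset; _∈_; _∉_; _⊆_; _∩_; _∪_; _─_; ∣_∣; Nonempty; ⁅_⁆; ⊤)
open import Data.Fin.Subset.Properties
  using (_∈?_; _⊆?_; nonempty?; x∈⁅x⁆; x∈⁅y⁆⇒x≡y; ∣⁅x⁆∣≡1; x∈p∩q⁺; x∈p∪q⁺; x∈p∪q⁻;
         p⊆q⇒∣p∣≤∣q∣; p⊂q⇒∣p∣<∣q∣; ∣p∣≤n; ∈⊤; x∈p∧x∉q⇒x∈p─q; drop-∷-⊆)
open import Data.List.Base as List using (List; []; _∷_; length)
open import Data.List.Extrema.Nat using (xs≤max; argmin-sel)
open import Data.List.Membership.Propositional using () renaming (_∈_ to _∈ˡ_; _∉_ to _∉ˡ_)
open import Data.List.Membership.Propositional.Properties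
  using (∈-map⁺; ∈-map⁻; ∈-filter⁺; ∈-filter⁻; ∈-allFin)
open import Data.List.Properties using (length-map)
open import Data.List.Relation.Unary.All as All using ()
open import Data.List.Relation.Unary.Any using (here; there; index; any?)
open import Data.List.Relation.Unary.Any.Properties using (lookup-index)
open import Data.Nat.Base as ℕ
  using (ℕ; zero; suc; _≤_; _<_; _+_; _*_; _^_; s≤s; ⌊_/2⌋; ⌈_/2⌉)
open import Data.Nat.Logarithm using (⌊log₂_⌋; ⌊log₂⌋-mono-≤; ⌊log₂[2^n]⌋≡n)
import Data.Nat.Properties as ℕ
open import Data.Nat.Solver using () renaming (module +-*-Solver to ℕ-Solver)
open import Data.Product.Base using (_×_; _,_; proj₁; proj₂; ∃-syntax)
open import Data.Rational.Base as ℚ using (ℚ; 0ℚ; 1ℚ; ½; 1/_)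
import Data.Rational.Properties as ℚ
open import Data.Rational.Solver using (module +-*-Solver)
open import Data.Sum.Base using (_⊎_; inj₁; inj₂)
open import Data.Vec.Base using ([]; _∷_; here; there)
open import Data.Vec.Functional using (Vector; foldr)
open import Data.Vec.Properties using (lookup∘tabulate; lookup⇒[]=)
open import Function.Base using (_∘_; case_of_)
open import Relation.Binary.PropositionalEquality
  using (_≡_; _≢_; refl; sym; trans; cong; cong₂; subst; module ≡-Reasoning)
open import Relation.Nullary.Decidable using (yes; no; decidable-stable; dec-true; _×-dec_)
open import Relation.Nullary.Negation using (¬_; contradiction)

-- Finite subsets

elements : ∀ {n} → Subset n → List (Fin n)
elements []          = []
elements (false ∷ p) = List.map suc (elements p)
elements (true ∷ p)  = zero ∷ List.map suc (elements p)

length-elements : ∀ {n} (p : Subset n) → length (elements p) ≡ ∣ p ∣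
length-elements []          = refl
length-elements (false ∷ p) = trans (length-map suc (elements p)) (length-elements p)
length-elements (true ∷ p)  =
  cong suc (trans (length-map suc (elements p)) (length-elements p))

∈-elements : ∀ {n} {p : Subset n} {x} → x ∈ p → x ∈ˡ elements p
∈-elements {p = true ∷ p}  here        = here refl
∈-elements {p = false ∷ p} (there x∈p) = ∈-map⁺ suc (∈-elements x∈p)
∈-elements {p = true ∷ p}  (there x∈p) = there (∈-map⁺ suc (∈-elements x∈p))

∣p─q∣+∣q∣≡∣p∣ : ∀ {n} {p q : Subset n} → q ⊆ p → ∣ p ─ q ∣ + ∣ q ∣ ≡ ∣ p ∣
∣p─q∣+∣q∣≡∣p∣ {p = []}        {[]}        q⊆p = refl
∣p─q∣+∣q∣≡∣p∣ {p = false ∷ p} {false ∷ q} q⊆p = ∣p─q∣+∣q∣≡∣p∣ (drop-∷-⊆ q⊆p)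
∣p─q∣+∣q∣≡∣p∣ {p = false ∷ p} {true ∷ q}  q⊆p with () ← q⊆p here
∣p─q∣+∣q∣≡∣p∣ {p = true ∷ p}  {false ∷ q} q⊆p = cong suc (∣p─q∣+∣q∣≡∣p∣ (drop-∷-⊆ q⊆p))
∣p─q∣+∣q∣≡∣p∣ {p = true ∷ p}  {true ∷ q}  q⊆p =
  trans (ℕ.+-suc ∣ p ─ q ∣ ∣ q ∣) (cong suc (∣p─q∣+∣q∣≡∣p∣ (drop-∷-⊆ q⊆p)))

-- As `T` has more than half of `S`, fewer than `⌈ ∣ S ∣ /2⌉` vertices remain. Strict bounds on both
-- sides let the recursion descend through powers of two.
∣S─T∣-halves : ∀ {n} {S T : Subset n} {k} → T ⊆ S →
  ⌊ ∣ S ∣ /2⌋ + 1 ≤ ∣ T ∣ → ∣ S ∣ < 2 * k → ∣ S ─ T ∣ < k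
∣S─T∣-halves {S = S} {T} {k} T⊆S large ∣S∣<2k = ℕ.≤-trans
  (ℕ.+-cancelʳ-≤ ⌊ ∣ S ∣ /2⌋ _ _ (begin
    suc ∣ S ─ T ∣ + ⌊ ∣ S ∣ /2⌋     ≡⟨ ℕ.+-suc ∣ S ─ T ∣ _ ⟨
    ∣ S ─ T ∣ + suc ⌊ ∣ S ∣ /2⌋     ≡⟨ cong (∣ S ─ T ∣ +_) (ℕ.+-comm 1 ⌊ ∣ S ∣ /2⌋) ⟩
    ∣ S ─ T ∣ + (⌊ ∣ S ∣ /2⌋ + 1)   ≤⟨ ℕ.+-monoʳ-≤ ∣ S ─ T ∣ large ⟩
    ∣ S ─ T ∣ + ∣ T ∣               ≡⟨ ∣p─q∣+∣q∣≡∣p∣ T⊆S ⟩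
    ∣ S ∣                           ≡⟨ ℕ.⌊n/2⌋+⌈n/2⌉≡n ∣ S ∣ ⟨
    ⌊ ∣ S ∣ /2⌋ + ⌈ ∣ S ∣ /2⌉       ≡⟨ ℕ.+-comm ⌊ ∣ S ∣ /2⌋ _ ⟩
    ⌈ ∣ S ∣ /2⌉ + ⌊ ∣ S ∣ /2⌋       ∎))
  (begin
    -- `⌈ n /2⌉` unfolds to `⌊ suc n /2⌋`, which fits the strict bound on `∣ S ∣`.
    ⌈ ∣ S ∣ /2⌉                     ≤⟨ ℕ.⌊n/2⌋-mono ∣S∣<2k ⟩
    ⌊ 2 * k /2⌋                     ≡⟨ cong (λ z → ⌊ k + z /2⌋) (ℕ.+-identityʳ k) ⟩
    ⌊ k + k /2⌋                     ≡⟨ ℕ.n≡⌊n+n/2⌋ k ⟨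
    k                               ∎)
  where open ℕ.≤-Reasoning

-- The three names may coincide, so that sets of one or two elements need no separate treatment
-- later.
cover₃ : ∀ {n} (p : Subset n) → Nonempty p → ∣ p ∣ ≤ 3 →
  ∃[ x ] ∃[ y ] ∃[ z ] (∀ {v} → v ∈ p → v ≡ x ⊎ v ≡ y ⊎ v ≡ z)
cover₃ p (w , w∈p) ∣p∣≤3 = go (elements p) ∈-elements
  (subst (_≤ 3) (sym (length-elements p)) ∣p∣≤3)
  where
  go : ∀ l → (∀ {v} → v ∈ p → v ∈ˡ l) → length l ≤ 3 →
    ∃[ x ] ∃[ y ] ∃[ z ] (∀ {v} → v ∈ p → v ≡ x ⊎ v ≡ y ⊎ v ≡ z)
  go []              inl _ with () ← inl w∈p
  go (x ∷ [])        inl _ = x , x , x , λ v∈p → case inl v∈p of λ where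
    (here e) → inj₁ e
  go (x ∷ y ∷ [])    inl _ = x , y , y , λ v∈p → case inl v∈p of λ where
    (here e)         → inj₁ e
    (there (here e)) → inj₂ (inj₁ e)
  go (x ∷ y ∷ z ∷ []) inl _ = x , y , z , λ v∈p → case inl v∈p of λ where
    (here e)                 → inj₁ e
    (there (here e))         → inj₂ (inj₁ e)
    (there (there (here e))) → inj₂ (inj₂ e)
  go (_ ∷ _ ∷ _ ∷ _ ∷ _) inl (s≤s (s≤s (s≤s ())))

-- Otherwise sending each `k` to its position in `l` would inject `Fin m` into fewer than `m`
-- positions.
fresh : ∀ {m} (l : List (Fin m)) → length l < m → ∃[ k ] k ∉ˡ l
fresh {m} l ∣l∣<m =
  Fin.¬∀⟶∃¬ m (_∈ˡ l) (λ k → any? (k Fin.≟_) l) λ all∈ →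
    let i , j , i<j , eq = Fin.pigeonhole ∣l∣<m (index ∘ all∈)
    in Fin.<⇒≢ i<j (trans (lookup-index (all∈ i))
         (trans (cong (List.lookup l) eq) (sym (lookup-index (all∈ j)))))

missed : ∀ {n m} (p : Subset n) (c : Fin n → Fin m) → ∣ p ∣ < m →
  ∃[ k ] (∀ {y} → y ∈ p → c y ≢ k)
missed {m = m} p c ∣p∣<m =
  let k , k∉ = fresh (List.map c (elements p))
                 (subst (_< m) (sym (trans (length-map c (elements p)) (length-elements p))) ∣p∣<m)
  in k , λ y∈p cy≡k → k∉ (subst (_∈ˡ _) cy≡k (∈-map⁺ c (∈-elements y∈p)))

-- Dimension of a graph and greedy colouring

module _ (G : Graph) where
  open Graph G using (Adj; adj?; symm; irrefl)

  private
    V : Set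
    V = Fin (order G)

  ∈-neighbours : ∀ {x y} → Adj x y → y ∈ neighbours G x
  ∈-neighbours {x} {y} xy = lookup⇒[]= y (neighbours G x)
    (trans (lookup∘tabulate _ y) (dec-true (adj? x y) xy))

  degree≤maxDegree : ∀ {S x} → x ∈ S → degree G S x ≤ maxDegree G S
  degree≤maxDegree {S} {x} x∈S = All.lookup (xs≤max 0 _)
    (∈-map⁺ (degree G S) (∈-filter⁺ (_∈? S) (∈-allFin x) x∈S))

  subdim≤dim : ∀ {S} → Nonempty S → subdim G S ≤ dim G
  subdim≤dim {S} ne = All.lookup (xs≤max 0 _)
    (∈-map⁺ (subdim G) (∈-filter⁺ nonempty? (allSubsets-complete S) ne))

  -- `min` returns its default or a list entry. The default is the value at `S`, itself a large
  -- subset because it is nonempty.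
  subdim-attained : ∀ {S} → Nonempty S →
    ∃[ T ] (T ⊆ S × ⌊ ∣ S ∣ /2⌋ + 1 ≤ ∣ T ∣ × maxDegree G T ≡ subdim G S)
  subdim-attained {S} (w , w∈S)
    with argmin-sel (λ x → x) (maxDegree G S) (List.map (maxDegree G) (largeSubsets G S))
  ... | inj₁ eq = S , (λ x∈S → x∈S) , large , sym eq
    where
    1≤∣S∣ : 1 ≤ ∣ S ∣
    1≤∣S∣ = subst (_≤ ∣ S ∣) (∣⁅x⁆∣≡1 w)
      (p⊆q⇒∣p∣≤∣q∣ λ x∈⁅w⁆ → subst (_∈ S) (sym (x∈⁅y⁆⇒x≡y w x∈⁅w⁆)) w∈S)
    large : ⌊ ∣ S ∣ /2⌋ + 1 ≤ ∣ S ∣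
    -- Abstracting `1≤∣S∣` together with `∣ S ∣` excludes the value zero.
    large with suc n ← ∣ S ∣ | _ ← 1≤∣S∣ = subst (_≤ suc n) (ℕ.+-comm 1 _) (ℕ.⌊n/2⌋<n n)
  ... | inj₂ mem =
    let T , T∈large , eq = ∈-map⁻ (maxDegree G) mem
        _ , T⊆S , large  = ∈-filter⁻ (λ T → (T ⊆? S) ×-dec (⌊ ∣ S ∣ /2⌋ + 1 ℕ.≤? ∣ T ∣))
                                      {xs = allSubsets (order G)} T∈large
    in T , T⊆S , large , sym eq

  -- The only consequence of the definition of `dim` used from here on; it supplies the set removed
  -- in each round.
  dim-large : ∀ {S} → Nonempty S →
    ∃[ T ] (T ⊆ S × ⌊ ∣ S ∣ /2⌋ + 1 ≤ ∣ T ∣ × maxDegree G T ≤ dim G)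
  dim-large ne =
    let T , T⊆S , large , eq = subdim-attained ne
    in T , T⊆S , large , subst (_≤ dim G) (sym eq) (subdim≤dim ne)

  -- Apply `dim-large` to the two ends of an edge: a large subset of a pair is the whole pair, and
  -- there `x` has degree at least 1.
  dim≡0⇒edgeless : dim G ≡ 0 → ∀ {x y} → ¬ Adj x y
  dim≡0⇒edgeless dim≡0 {x} {y} xy =
    let T , T⊆S , large , deg = dim-large (x , x∈S)
    in 2≰1 (s≤s (ℕ.≤-trans (one-edge T T⊆S (large-S T large))
                           (ℕ.≤-trans deg (ℕ.≤-reflexive dim≡0))))
    where
    2≰1 : ¬ 2 ≤ 1
    2≰1 (s≤s ())
    S : Subset (order G)
    S = ⁅ x ⁆ ∪ ⁅ y ⁆
    x∈S : x ∈ S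
    x∈S = x∈p∪q⁺ (inj₁ (x∈⁅x⁆ x))
    y∈S : y ∈ S
    y∈S = x∈p∪q⁺ (inj₂ (x∈⁅x⁆ y))
    2≤∣S∣ : 2 ≤ ∣ S ∣
    2≤∣S∣ = subst (_< ∣ S ∣) (∣⁅x⁆∣≡1 x) (p⊂q⇒∣p∣<∣q∣
      ((λ v∈ → x∈p∪q⁺ (inj₁ v∈)) , y , y∈S , λ y∈⁅x⁆ → irrefl (sym (x∈⁅y⁆⇒x≡y x y∈⁅x⁆)) xy))
    large-S : ∀ T → ⌊ ∣ S ∣ /2⌋ + 1 ≤ ∣ T ∣ → 2 ≤ ∣ T ∣
    large-S T = ℕ.≤-trans (ℕ.+-monoˡ-≤ 1 (ℕ.⌊n/2⌋-mono 2≤∣S∣))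
    ∣⊆⁅⁆∣ : ∀ {T : Subset (order G)} z → (∀ {v} → v ∈ T → v ≡ z) → ∣ T ∣ ≤ 1
    ∣⊆⁅⁆∣ {T} z h = subst (∣ T ∣ ≤_) (∣⁅x⁆∣≡1 z)
      (p⊆q⇒∣p∣≤∣q∣ λ v∈T → subst (_∈ ⁅ z ⁆) (sym (h v∈T)) (x∈⁅x⁆ z))
    split : ∀ {T : Subset (order G)} → T ⊆ S → ∀ {v} → v ∈ T → v ≡ x ⊎ v ≡ y
    split T⊆S v∈T with x∈p∪q⁻ ⁅ x ⁆ ⁅ y ⁆ (T⊆S v∈T)
    ... | inj₁ v∈ = inj₁ (x∈⁅y⁆⇒x≡y x v∈)
    ... | inj₂ v∈ = inj₂ (x∈⁅y⁆⇒x≡y y v∈)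
    x∈T : ∀ {T} → T ⊆ S → 2 ≤ ∣ T ∣ → x ∈ T
    x∈T {T} T⊆S 2≤ = decidable-stable (x ∈? T) λ x∉T → 2≰1 (ℕ.≤-trans 2≤ (∣⊆⁅⁆∣ y λ v∈T →
      case split T⊆S v∈T of λ where
        (inj₁ refl) → contradiction v∈T x∉T
        (inj₂ e)    → e))
    y∈T : ∀ {T} → T ⊆ S → 2 ≤ ∣ T ∣ → y ∈ T
    y∈T {T} T⊆S 2≤ = decidable-stable (y ∈? T) λ y∉T → 2≰1 (ℕ.≤-trans 2≤ (∣⊆⁅⁆∣ x λ v∈T →
      case split T⊆S v∈T of λ where
        (inj₁ e)    → e
        (inj₂ refl) → contradiction v∈T y∉T))
    one-edge : ∀ T → T ⊆ S → 2 ≤ ∣ T ∣ → 1 ≤ maxDegree G T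
    one-edge T T⊆S 2≤ = ℕ.≤-trans
      (subst (_≤ degree G T x) (∣⁅x⁆∣≡1 y) (p⊆q⇒∣p∣≤∣q∣ λ v∈ →
        subst (_∈ _) (sym (x∈⁅y⁆⇒x≡y y v∈)) (x∈p∩q⁺ (y∈T T⊆S 2≤ , ∈-neighbours xy))))
      (degree≤maxDegree (x∈T T⊆S 2≤))

  ProperOn : ∀ {m} → Subset (order G) → (V → Fin m) → Set
  ProperOn T c = ∀ {x y} → x ∈ T → y ∈ T → Adj x y → c x ≢ c y

  -- Colour the vertices of `T` one after another: each has at most `D` neighbours in `T`, so one of
  -- `suc D` colours is free.
  greedy : ∀ {D T} → maxDegree G T ≤ D → ∃[ c ] ProperOn {suc D} T c
  greedy {D} {T} Δ≤D =
    let c , proper = colour (elements T)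
    in c , λ x∈T y∈T → proper x∈T y∈T (∈-elements x∈T) (∈-elements y∈T)
    where
    ProperFor : List V → (V → Fin (suc D)) → Set
    ProperFor l c = ∀ {x y} → x ∈ T → y ∈ T → x ∈ˡ l → y ∈ˡ l → Adj x y → c x ≢ c y
    colour : ∀ l → ∃[ c ] ProperFor l c
    colour []      = (λ _ → zero) , λ _ _ ()
    colour (v ∷ l) with v ∈? T
    ... | no v∉T = let c , proper = colour l in c , λ x∈T y∈T x∈ y∈ →
      proper x∈T y∈T (tail v∉T x∈T x∈) (tail v∉T y∈T y∈)
      where
      tail : ∀ {x} → v ∉ T → x ∈ T → x ∈ˡ v ∷ l → x ∈ˡ l
      tail v∉T x∈T (here refl) = contradiction x∈T v∉T
      tail v∉T x∈T (there x∈l) = x∈l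
    ... | yes v∈T = c′ , proper′
      where
      c = proj₁ (colour l)
      proper = proj₂ (colour l)
      -- This avoids the colours of all neighbours in `T`, even those outside `l`, whose colours are
      -- still arbitrary; the degree bound leaves a colour anyway.
      free = missed (T ∩ neighbours G v) c
        (s≤s (ℕ.≤-trans (degree≤maxDegree v∈T) Δ≤D))
      c′ : V → Fin (suc D)
      c′ x with x Fin.≟ v
      ... | yes _ = proj₁ free
      ... | no  _ = c x
      ∈-tail : ∀ {x} → x ≢ v → x ∈ˡ v ∷ l → x ∈ˡ l
      ∈-tail x≢v (here x≡v)  = contradiction x≡v x≢v
      ∈-tail x≢v (there x∈l) = x∈l
      proper′ : ProperFor (v ∷ l) c′
      proper′ {x} {y} x∈T y∈T x∈ y∈ xy with x Fin.≟ v | y Fin.≟ v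
      ... | yes refl | yes refl = contradiction xy (irrefl refl)
      ... | yes refl | no _     =
        λ e → proj₂ free (x∈p∩q⁺ (y∈T , ∈-neighbours xy)) (sym e)
      ... | no _     | yes refl =
        λ e → proj₂ free (x∈p∩q⁺ (x∈T , ∈-neighbours (symm xy))) e
      ... | no x≢v   | no y≢v   = proper x∈T y∈T (∈-tail x≢v x∈) (∈-tail y≢v y∈) xy

-- Rational points of the circle of radius 1/√2

Point : Set
Point = ℚ × ℚ

infix 7 _·_

_·_ : Point → Point → ℚ
(x , y) · (x′ , y′) = x ℚ.* x′ ℚ.+ y ℚ.* y′

fromℕ : ℕ → ℚ
fromℕ zero    = 0ℚ
fromℕ (suc n) = 1ℚ ℚ.+ fromℕ n

0≤fromℕ : ∀ n → 0ℚ ℚ.≤ fromℕ n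
0≤fromℕ zero    = ℚ.≤-refl
0≤fromℕ (suc n) = ℚ.+-mono-≤ {0ℚ} {1ℚ} (ℚ.<⇒≤ (ℚ.positive⁻¹ 1ℚ)) (0≤fromℕ n)

fromℕ-suc≢0 : ∀ n → fromℕ (suc n) ≢ 0ℚ
fromℕ-suc≢0 n eq = ℚ.<-irrefl (sym eq) (ℚ.+-mono-<-≤ {0ℚ} {1ℚ} (ℚ.positive⁻¹ 1ℚ) (0≤fromℕ n))

fromℕ-injective : ∀ {m n} → fromℕ m ≡ fromℕ n → m ≡ n
fromℕ-injective {zero}  {zero}  _  = refl
fromℕ-injective {zero}  {suc n} eq = contradiction (sym eq) (fromℕ-suc≢0 n)
fromℕ-injective {suc m} {zero}  eq = contradiction eq (fromℕ-suc≢0 m)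
fromℕ-injective {suc m} {suc n} eq = cong suc (fromℕ-injective (+-cancelˡ 1ℚ _ _ eq))
  where open import Algebra.Properties.Group ℚ.+-0-group using () renaming (∙-cancelˡ to +-cancelˡ)

1+sq : ℚ → ℚ
1+sq u = 1ℚ ℚ.+ u ℚ.* u

1+sq-positive : ∀ n → ℚ.Positive (1+sq (fromℕ n))
1+sq-positive n = ℚ.positive (ℚ.+-mono-<-≤ {0ℚ} {1ℚ} (ℚ.positive⁻¹ 1ℚ)
  (subst (ℚ._≤ fromℕ n ℚ.* fromℕ n) (ℚ.*-zeroˡ (fromℕ n))
    (ℚ.*-monoʳ-≤-nonNeg (fromℕ n) {{ℚ.nonNegative (0≤fromℕ n)}} (0≤fromℕ n))))

recip : ℕ → ℚ
recip n = 1/ 1+sq (fromℕ n)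
  where instance _ = ℚ.pos⇒nonZero (1+sq (fromℕ n)) {{1+sq-positive n}}

recip-inverse : ∀ n → recip n ℚ.* 1+sq (fromℕ n) ≡ 1ℚ
recip-inverse n = ℚ.*-inverseˡ (1+sq (fromℕ n))
  where instance _ = ℚ.pos⇒nonZero (1+sq (fromℕ n)) {{1+sq-positive n}}

-- The point ((1 - u²) / (1 + u²) , 2u / (1 + u²)) of the unit circle, turned by
-- 45° and shrunk by √2, which makes it rational.
turned : ℚ → ℚ → Point
turned u r = ½ ℚ.* ((1ℚ ℚ.- u ℚ.* u) ℚ.* r ℚ.- (1ℚ ℚ.+ 1ℚ) ℚ.* u ℚ.* r)
           , ½ ℚ.* ((1ℚ ℚ.- u ℚ.* u) ℚ.* r ℚ.+ (1ℚ ℚ.+ 1ℚ) ℚ.* u ℚ.* r)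

circle : ℕ → Point
circle n = turned (fromℕ n) (recip n)

-- With `r` a free variable this is a polynomial identity, resting on (1 - u²)² + (2u)² = (1 + u²)².
-- Only afterwards is r (1 + u²) = 1 used.
circle-norm : ∀ n → circle n · circle n ≡ ½
circle-norm n = trans (norm (fromℕ n) (recip n))
  (cong (λ z → ½ ℚ.* (z ℚ.* z)) (recip-inverse n))
  where
  open +-*-Solver
  norm : ∀ u r → turned u r · turned u r
    ≡ ½ ℚ.* ((r ℚ.* 1+sq u) ℚ.* (r ℚ.* 1+sq u))
  norm = solve 2 (λ u r →
    let a = (con 1ℚ :- u :* u) :* r
        b = (con 1ℚ :+ con 1ℚ) :* u :* r
        x = con ½ :* (a :- b)
        y = con ½ :* (a :+ b)
        w = r :* (con 1ℚ :+ u :* u)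
    in x :* x :+ y :* y := con ½ :* (w :* w)) refl

-- For a point (a , b) = ((1 - u²) r , 2 u r) of the unit circle, 1 + a = 2 r
-- and b = 2 u r, so the point determines r and u r, hence u.
circle-injective : ∀ {m n} → circle m ≡ circle n → m ≡ n
circle-injective {m} {n} eq = fromℕ-injective (begin
  u                                 ≡⟨ unscale u m ⟩
  (u ℚ.* recip m) ℚ.* w             ≡⟨ cong (ℚ._* w) ur≡ ⟩
  (u′ ℚ.* recip n) ℚ.* w            ≡⟨ cong (λ r → (u′ ℚ.* r) ℚ.* w) (sym r≡) ⟩
  (u′ ℚ.* recip m) ℚ.* w            ≡⟨ unscale u′ m ⟨
  u′                                ∎)
  where
  open ≡-Reasoning
  u  = fromℕ m
  u′ = fromℕ n
  w  = 1+sq u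
  unscale : ∀ v k → v ≡ (v ℚ.* recip k) ℚ.* 1+sq (fromℕ k)
  unscale v k = sym (trans (ℚ.*-assoc v _ _)
    (trans (cong (v ℚ.*_) (recip-inverse k)) (ℚ.*-identityʳ v)))
  read-r : ∀ k → ½ ℚ.* (1ℚ ℚ.+ (proj₁ (circle k) ℚ.+ proj₂ (circle k))) ≡ recip k
  read-r k = trans
    -- The coordinates add up to a. Writing 1 as r (1 + u²) turns 1 + a = 2 r into a polynomial
    -- identity.
    (cong (λ z → ½ ℚ.* (z ℚ.+ (proj₁ (circle k) ℚ.+ proj₂ (circle k)))) (sym (recip-inverse k)))
    (lemma (fromℕ k) (recip k))
    where
    open +-*-Solver
    lemma : ∀ u r → ½ ℚ.* (r ℚ.* 1+sq u ℚ.+ (proj₁ (turned u r) ℚ.+ proj₂ (turned u r))) ≡ r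
    lemma = solve 2 (λ u r →
      let a = (con 1ℚ :- u :* u) :* r
          b = (con 1ℚ :+ con 1ℚ) :* u :* r
          x = con ½ :* (a :- b)
          y = con ½ :* (a :+ b)
      in con ½ :* (r :* (con 1ℚ :+ u :* u) :+ (x :+ y)) := r) refl
  read-ur : ∀ k → ½ ℚ.* (proj₂ (circle k) ℚ.- proj₁ (circle k)) ≡ fromℕ k ℚ.* recip k
  read-ur k = lemma (fromℕ k) (recip k)
    where
    open +-*-Solver
    lemma : ∀ u r → ½ ℚ.* (proj₂ (turned u r) ℚ.- proj₁ (turned u r)) ≡ u ℚ.* r
    lemma = solve 2 (λ u r →
      let a = (con 1ℚ :- u :* u) :* r
          b = (con 1ℚ :+ con 1ℚ) :* u :* r
          x = con ½ :* (a :- b)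
          y = con ½ :* (a :+ b)
      in con ½ :* (y :- x) := u :* r) refl
  r≡ : recip m ≡ recip n
  r≡ = trans (sym (read-r m)) (trans
    (cong (λ p → ½ ℚ.* (1ℚ ℚ.+ (proj₁ p ℚ.+ proj₂ p))) eq) (read-r n))
  ur≡ : u ℚ.* recip m ≡ u′ ℚ.* recip n
  ur≡ = trans (sym (read-ur m)) (trans (cong (λ p → ½ ℚ.* (proj₂ p ℚ.- proj₁ p)) eq) (read-ur n))

-- Orthogonal planes

sumℚ : ∀ {d} → Vector ℚ d → ℚ
sumℚ = foldr ℚ._+_ 0ℚ

inner distSq : ∀ {d} → Vector ℚ d → Vector ℚ d → ℚ
inner  u v = sumℚ (λ i → u i ℚ.* v i)
distSq u v = sumℚ (λ i → (u i ℚ.- v i) ℚ.* (u i ℚ.- v i))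

-- For vectors of squared norm ½ this reduces unit distance to orthogonality.
distSq-inner : ∀ {d} (u v : Vector ℚ d) →
  distSq u v ≡ inner u u ℚ.+ inner v v ℚ.- (inner u v ℚ.+ inner u v)
distSq-inner {zero}  u v = refl
distSq-inner {suc d} u v = trans
  (cong ((u zero ℚ.- v zero) ℚ.* (u zero ℚ.- v zero) ℚ.+_) (distSq-inner (u ∘ suc) (v ∘ suc)))
  (lemma (u zero) (v zero)
    (inner (u ∘ suc) (u ∘ suc)) (inner (v ∘ suc) (v ∘ suc)) (inner (u ∘ suc) (v ∘ suc)))
  where
  open +-*-Solver
  lemma : ∀ a b p q r →
    (a ℚ.- b) ℚ.* (a ℚ.- b) ℚ.+ (p ℚ.+ q ℚ.- (r ℚ.+ r)) ≡
    (a ℚ.* a ℚ.+ p) ℚ.+ (b ℚ.* b ℚ.+ q) ℚ.- ((a ℚ.* b ℚ.+ r) ℚ.+ (a ℚ.* b ℚ.+ r))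
  lemma = solve 5 (λ a b p q r →
    (a :- b) :* (a :- b) :+ (p :+ q :- (r :+ r)) :=
    (a :* a :+ p) :+ (b :* b :+ q) :- ((a :* b :+ r) :+ (a :* b :+ r))) refl

inner-zeroˡ : ∀ {d} (v : Vector ℚ d) → inner (λ _ → 0ℚ) v ≡ 0ℚ
inner-zeroˡ {zero}  v = refl
inner-zeroˡ {suc d} v = cong₂ ℚ._+_ (ℚ.*-zeroˡ (v zero)) (inner-zeroˡ (v ∘ suc))

inner-comm : ∀ {d} (u v : Vector ℚ d) → inner u v ≡ inner v u
inner-comm {zero}  u v = refl
inner-comm {suc d} u v = cong₂ ℚ._+_ (ℚ.*-comm (u zero) (v zero)) (inner-comm (u ∘ suc) (v ∘ suc))

inner-congʳ : ∀ {d} (u : Vector ℚ d) {v w} → (∀ k → v k ≡ w k) → inner u v ≡ inner u w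
inner-congʳ {zero}  u eq = refl
inner-congʳ {suc d} u eq =
  cong₂ ℚ._+_ (cong (u zero ℚ.*_) (eq zero)) (inner-congʳ (u ∘ suc) (eq ∘ suc))

-- The dimension is `m * 2` because this computes to two successors per plane, so coordinates can be
-- matched on.
inPlane : ∀ {m} → Fin m → Point → Vector ℚ (m * 2)
inPlane zero    (x , y) zero          = x
inPlane zero    (x , y) (suc zero)    = y
inPlane zero    _       (suc (suc k)) = 0ℚ
inPlane (suc i) _       zero          = 0ℚ
inPlane (suc i) _       (suc zero)    = 0ℚ
inPlane (suc i) p       (suc (suc k)) = inPlane i p k

inPlane-injective : ∀ {m} (i : Fin m) {p q} → (∀ k → inPlane i p k ≡ inPlane i q k) → p ≡ q
inPlane-injective zero    eq = cong₂ _,_ (eq zero) (eq (suc zero))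
inPlane-injective (suc i) eq = inPlane-injective i (λ k → eq (suc (suc k)))

0+0+ : ∀ z → 0ℚ ℚ.+ (0ℚ ℚ.+ z) ≡ z
0+0+ z = trans (ℚ.+-identityˡ (0ℚ ℚ.+ z)) (ℚ.+-identityˡ z)

inner-same : ∀ {m} (i : Fin m) p q → inner (inPlane i p) (inPlane i q) ≡ p · q
inner-same {suc m} zero (x , y) (x′ , y′) = cong (x ℚ.* x′ ℚ.+_)
  (trans (cong (y ℚ.* y′ ℚ.+_) (inner-zeroˡ {m * 2} (λ _ → 0ℚ))) (ℚ.+-identityʳ (y ℚ.* y′)))
inner-same (suc i) p q = trans (0+0+ _) (inner-same i p q)

inner-distinct : ∀ {m} {i j : Fin m} → i ≢ j → ∀ p q → inner (inPlane i p) (inPlane j q) ≡ 0ℚ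
inner-distinct {i = zero}  {zero}  i≢j p q = contradiction refl i≢j
inner-distinct {i = zero}  {suc j} i≢j (x , y) q =
  cong₂ ℚ._+_ (ℚ.*-zeroʳ x) (cong₂ ℚ._+_ (ℚ.*-zeroʳ y) (inner-zeroˡ (inPlane j q)))
inner-distinct {suc m} {suc i} {zero} i≢j p q = trans
  (inner-comm (inPlane {suc m} (suc i) p) (inPlane {suc m} zero q))
  (inner-distinct {suc m} {zero} {suc i} (i≢j ∘ sym) q p)
inner-distinct {i = suc i} {suc j} i≢j p q = trans (0+0+ _) (inner-distinct (i≢j ∘ cong suc) p q)

-- Transfer to the reals

≡⇒≃ : ∀ {x y} → (∀ n → seq x n ≡ seq y n) → x ≃ y
≡⇒≃ {x} {y} eq ε 0<ε = 0 , λ n _ →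
  subst (ℚ._< ε) (sym (cong ℚ.∣_∣ (trans (cong (ℚ._- seq y n) (eq n)) (ℚ.+-inverseʳ (seq y n)))))
    0<ε

-- For p ≢ q, taking ε to be ∣p - q∣ would make this constant smaller than itself.
fromℚ-injective : ∀ {p q} → fromℚ p ≃ fromℚ q → p ≡ q
fromℚ-injective {p} {q} p≃q = decidable-stable (p ℚ.≟ q) λ p≢q →
  ℚ.<-irrefl refl (proj₂ (p≃q ℚ.∣ p ℚ.- q ∣ (0<∣p-q∣ p≢q)) _ ℕ.≤-refl)
  where
  open import Algebra.Properties.Group ℚ.+-0-group using (x∙y⁻¹≈ε⇒x≈y)
  0<∣p-q∣ : p ≢ q → 0ℚ ℚ.< ℚ.∣ p ℚ.- q ∣
  0<∣p-q∣ p≢q = ℚ.≰⇒> λ ≤0 → p≢q (x∙y⁻¹≈ε⇒x≈y p q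
    (ℚ.∣p∣≡0⇒p≡0 _ (ℚ.≤-antisym ≤0 (ℚ.0≤∣p∣ _))))

0ᴿ≤1ᴿ : 0ᴿ ≤ᴿ 1ᴿ
0ᴿ≤1ᴿ ε 0<ε = 0 , λ _ _ → ℚ.+-mono-< {0ℚ} {1ℚ} {0ℚ} {ε} (ℚ.positive⁻¹ 1ℚ) 0<ε

-- The real operations act termwise, so exact rational computations settle real distances.
seq-∑ : ∀ {d} (u v : Vector ℚ d) n →
  seq (∑ (λ i → (fromℚ (u i) -ᴿ fromℚ (v i)) *ᴿ (fromℚ (u i) -ᴿ fromℚ (v i)))) n ≡ distSq u v
seq-∑ {zero}  u v n = refl
seq-∑ {suc d} u v n =
  cong ((u zero ℚ.- v zero) ℚ.* (u zero ℚ.- v zero) ℚ.+_) (seq-∑ (u ∘ suc) (v ∘ suc) n)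

unit-distance : ∀ {d} (u v : Vector ℚ d) → distSq u v ≡ 1ℚ → ‖ (fromℚ ∘ u) ⊖ (fromℚ ∘ v) ‖≃ 1ᴿ
unit-distance u v eq = 0ᴿ≤1ᴿ ,
  ≡⇒≃ {1ᴿ *ᴿ 1ᴿ} {∑ (λ i → w i *ᴿ w i)} (λ n → sym (trans (seq-∑ u v n) eq))
  where w = (fromℚ ∘ u) ⊖ (fromℚ ∘ v)

-- Placing vertices on circles in orthogonal planes

-- A plane, and the parameter of a point on its circle.
Spot : ℕ → Set
Spot m = Fin m × ℕ

-- A sufficient condition for orthogonality. The pair of parameters 0 and 1 on one circle serves the
-- final round.
data UnitApart {m} : Spot m → Spot m → Set where
  distinct : ∀ {i j s t} → i ≢ j → UnitApart (i , s) (j , t)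
  perp₀₁   : ∀ {i} → UnitApart (i , 0) (i , 1)
  perp₁₀   : ∀ {i} → UnitApart (i , 1) (i , 0)

vector : ∀ {m} → Spot m → Vector ℚ (m * 2)
vector (i , t) = inPlane i (circle t)

vector-norm : ∀ {m} (a : Spot m) → inner (vector a) (vector a) ≡ ½
vector-norm (i , t) = trans (inner-same i (circle t) (circle t)) (circle-norm t)

-- Equal vectors in different planes would be orthogonal to themselves, against their squared norm
-- ½.
vector-injective : ∀ {m} (a b : Spot m) → (∀ k → vector a k ≡ vector b k) → a ≡ b
vector-injective a@(i , s) b@(j , t) eq with i Fin.≟ j
... | yes refl = cong (i ,_) (circle-injective (inPlane-injective i eq))
... | no i≢j   = contradiction
  (trans (sym (vector-norm a)) (trans (inner-congʳ (vector a) eq)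
    (inner-distinct i≢j (circle s) (circle t)))) λ ()

vector-orthogonal : ∀ {m} {a b : Spot m} → UnitApart a b → inner (vector a) (vector b) ≡ 0ℚ
vector-orthogonal (distinct i≢j) = inner-distinct i≢j _ _
-- circle 0 = (½ , ½) and circle 1 = (-½ , ½).
vector-orthogonal (perp₀₁ {i})   = inner-same i (circle 0) (circle 1)
vector-orthogonal (perp₁₀ {i})   = inner-same i (circle 1) (circle 0)

vector-distance : ∀ {m} {a b : Spot m} → UnitApart a b → distSq (vector a) (vector b) ≡ 1ℚ
vector-distance {a = a} {b} ab = trans (distSq-inner (vector a) (vector b))
  (cong₂ ℚ._-_ (cong₂ ℚ._+_ (vector-norm a) (vector-norm b))
    (cong₂ ℚ._+_ (vector-orthogonal ab) (vector-orthogonal ab)))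

-- Frees the first `c` planes for the colours of a new round.
shift : ∀ c {m} → Spot m → Spot (c + m)
shift c (i , t) = c ↑ʳ i , t

shift-injective : ∀ c {m} {a b : Spot m} → shift c a ≡ shift c b → a ≡ b
shift-injective c eq = cong₂ _,_ (Fin.↑ʳ-injective c _ _ (cong proj₁ eq)) (cong proj₂ eq)

shift-UnitApart : ∀ c {m} {a b : Spot m} → UnitApart a b → UnitApart (shift c a) (shift c b)
shift-UnitApart c (distinct i≢j) = distinct (i≢j ∘ Fin.↑ʳ-injective c _ _)
shift-UnitApart c perp₀₁         = perp₀₁
shift-UnitApart c perp₁₀         = perp₁₀

↑ˡ≢↑ʳ : ∀ {c m} (i : Fin c) (j : Fin m) → i ↑ˡ m ≢ c ↑ʳ j
↑ˡ≢↑ʳ {c} {m} i j eq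
  with () ← trans (sym (Fin.splitAt-↑ˡ c i m)) (trans (cong (splitAt c) eq) (Fin.splitAt-↑ʳ c m j))

module _ (G : Graph) where
  open Graph G using (Adj; symm; irrefl)

  private
    V : Set
    V = Fin (order G)

  -- `spot` is total, but its values outside `S` are unconstrained; this avoids carrying membership
  -- proofs with the vertices.
  record Placement (S : Subset (order G)) (m : ℕ) : Set where
    field
      spot      : V → Spot m
      injective : ∀ {x y} → x ∈ S → y ∈ S → spot x ≡ spot y → x ≡ y
      apart     : ∀ {x y} → x ∈ S → y ∈ S → Adj x y → UnitApart (spot x) (spot y)

  open Placement

  placement⇒embeds : ∀ {m} → Placement ⊤ m → Embeds G (m * 2)
  placement⇒embeds P =
      (λ x → fromℚ ∘ vector (spot P x))
    , (λ eq → injective P ∈⊤ ∈⊤ (vector-injective _ _ (fromℚ-injective ∘ eq)))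
    , λ {x} {y} xy → unit-distance (vector (spot P x)) (vector (spot P y))
               (vector-distance (apart P ∈⊤ ∈⊤ xy))

  -- One circle has infinitely many rational points, enough for any number of pairwise non-adjacent
  -- vertices.
  edgeless-placement : (∀ {x y} → ¬ Adj x y) → Placement ⊤ 1
  edgeless-placement edgeless = record
    { spot      = λ x → zero , toℕ x
    ; injective = λ _ _ eq → Fin.toℕ-injective (cong proj₂ eq)
    ; apart     = λ _ _ xy → contradiction xy edgeless
    }

  -- One plane is required since `spot` needs some value.
  empty-placement : ∀ {S m} → ¬ Nonempty S → Placement S (suc m)
  empty-placement S-empty = record
    { spot      = λ _ → zero , 0
    ; injective = λ x∈S → contradiction (_ , x∈S) S-empty
    ; apart     = λ x∈S → contradiction (_ , x∈S) S-empty
    }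

  -- Two vertices go to orthogonal points of the first circle and the third to the second circle, so
  -- even a triangle fits.
  small-placement : ∀ {S m} → Nonempty S → ∣ S ∣ ≤ 3 → Placement S (suc (suc m))
  small-placement {S} {m} ne ∣S∣≤3 =
    let x , y , z , cover = cover₃ S ne ∣S∣≤3 in place x y z cover
    where
    place : ∀ x y z → (∀ {v} → v ∈ S → v ≡ x ⊎ v ≡ y ⊎ v ≡ z) → Placement S (suc (suc m))
    place x y z cover = record { spot = at ; injective = inj ; apart = far }
      where
      at : V → Spot (suc (suc m))
      -- If the names coincide, the earlier test decides.
      at v with v Fin.≟ x | v Fin.≟ y
      ... | yes _ | _     = zero , 0
      ... | no _  | yes _ = zero , 1
      ... | no _  | no _  = suc zero , 0
      is-z : ∀ {v} → v ∈ S → v ≢ x → v ≢ y → v ≡ z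
      is-z v∈S v≢x v≢y with cover v∈S
      ... | inj₁ e        = contradiction e v≢x
      ... | inj₂ (inj₁ e) = contradiction e v≢y
      ... | inj₂ (inj₂ e) = e
      inj : ∀ {v w} → v ∈ S → w ∈ S → at v ≡ at w → v ≡ w
      inj {v} {w} v∈S w∈S eq with v Fin.≟ x | v Fin.≟ y | w Fin.≟ x | w Fin.≟ y
      inj _ _ _  | yes refl | _        | yes refl | _        = refl
      inj _ _ () | yes _    | _        | no _     | yes _
      inj _ _ () | yes _    | _        | no _     | no _
      inj _ _ () | no _     | yes _    | yes _    | _
      inj _ _ _  | no _     | yes refl | no _     | yes refl = refl
      inj _ _ () | no _     | yes _    | no _     | no _
      inj _ _ () | no _     | no _     | yes _    | _
      inj _ _ () | no _     | no _     | no _     | yes _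
      inj v∈S w∈S _ | no v≢x | no v≢y  | no w≢x   | no w≢y   =
        trans (is-z v∈S v≢x v≢y) (sym (is-z w∈S w≢x w≢y))
      far : ∀ {v w} → v ∈ S → w ∈ S → Adj v w → UnitApart (at v) (at w)
      far {v} {w} v∈S w∈S vw with v Fin.≟ x | v Fin.≟ y | w Fin.≟ x | w Fin.≟ y
      ... | yes refl | _        | yes refl | _        = contradiction vw (irrefl refl)
      ... | yes _    | _        | no _     | yes _    = perp₀₁
      ... | yes _    | _        | no _     | no _     = distinct λ ()
      ... | no _     | yes _    | yes _    | _        = perp₁₀
      ... | no _     | yes refl | no _     | yes refl = contradiction vw (irrefl refl)
      ... | no _     | yes _    | no _     | no _     = distinct λ ()
      ... | no _     | no _     | yes _    | _        = distinct λ ()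
      ... | no _     | no _     | no _     | yes _    = distinct λ ()
      ... | no v≢x   | no v≢y   | no w≢x   | no w≢y   =
        contradiction vw (irrefl (trans (is-z v∈S v≢x v≢y) (sym (is-z w∈S w≢x w≢y))))

  -- Each colour class gets a new plane. Its members are non-adjacent, so they may share a circle at
  -- any distinct points; their own numbers serve as parameters.
  colour-and-place : ∀ {S T c m} (colour : V → Fin c) → ProperOn G T colour →
    Placement (S ─ T) m → Placement S (c + m)
  colour-and-place {S} {T} {c} {m} colour proper P =
    record { spot = at ; injective = inj ; apart = far }
    where
    at : V → Spot (c + m)
    at v with v ∈? T
    ... | yes _ = colour v ↑ˡ m , toℕ v
    ... | no  _ = shift c (spot P v)
    rest : ∀ {v} → v ∈ S → v ∉ T → v ∈ S ─ T
    rest = x∈p∧x∉q⇒x∈p─q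
    inj : ∀ {v w} → v ∈ S → w ∈ S → at v ≡ at w → v ≡ w
    inj {v} {w} v∈S w∈S eq with v ∈? T | w ∈? T
    ... | yes _  | yes _  = Fin.toℕ-injective (cong proj₂ eq)
    ... | yes _  | no _   = contradiction (cong proj₁ eq) (↑ˡ≢↑ʳ _ _)
    ... | no _   | yes _  = contradiction (sym (cong proj₁ eq)) (↑ˡ≢↑ʳ _ _)
    ... | no v∉T | no w∉T = injective P (rest v∈S v∉T) (rest w∈S w∉T) (shift-injective c eq)
    far : ∀ {v w} → v ∈ S → w ∈ S → Adj v w → UnitApart (at v) (at w)
    far {v} {w} v∈S w∈S vw with v ∈? T | w ∈? T
    ... | yes v∈T | yes w∈T = distinct (proper v∈T w∈T vw ∘ Fin.↑ˡ-injective m _ _)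
    ... | yes _   | no _    = distinct (↑ˡ≢↑ʳ _ _)
    ... | no _    | yes _   = distinct (↑ˡ≢↑ʳ _ _ ∘ sym)
    ... | no v∉T  | no w∉T  = shift-UnitApart c (apart P (rest v∈S v∉T) (rest w∈S w∉T) vw)

  -- `suc k` rounds of dim G + 1 planes each. The last one handles at most three vertices, and dim G
  -- ≥ 1 ensures the two planes it needs.
  placement : ∀ {D} → dim G ≡ suc D → ∀ k {S} → ∣ S ∣ < 2 ^ (2 + k) →
    Placement S (suc k * suc (suc D))
  placement dim≡ k {S} ∣S∣< with nonempty? S
  placement dim≡ k           ∣S∣< | no S-empty = empty-placement S-empty
  placement dim≡ zero        ∣S∣< | yes ne     = small-placement ne (ℕ.≤-pred ∣S∣<)
  placement dim≡ (suc k) {S} ∣S∣< | yes ne     =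
    let T , T⊆S , large , Δ≤dim = dim-large G ne
        colour , proper         = greedy G (ℕ.≤-trans Δ≤dim (ℕ.≤-reflexive dim≡))
    in colour-and-place colour proper
         -- `2 ^ (2 + suc k)` unfolds to twice `2 ^ (2 + k)`.
         (placement dim≡ k (∣S─T∣-halves {S = S} {k = 2 ^ (2 + k)} T⊆S large ∣S∣<))

  -- Covers the case of logarithm 0, where the bound allows no dimension at all.
  embeds-0 : order G ≤ 1 → Embeds G 0
  embeds-0 n≤1 =
    (λ _ ()) , (λ _ → all-equal _ _) , λ xy → contradiction xy (irrefl (all-equal _ _))
    where
    all-equal : (x y : V) → x ≡ y
    all-equal x y = Fin.toℕ-injective (trans (is-0 x) (sym (is-0 y)))
      where
      is-0 : ∀ (x : V) → toℕ x ≡ 0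
      is-0 x = ℕ.n<1⇒n≡0 (ℕ.≤-trans (Fin.toℕ<n x) n≤1)

-- The logarithm and the final count

n<2^[1+⌊log₂n⌋] : ∀ n → n < 2 ^ suc ⌊log₂ n ⌋
-- If the power were at most n, monotonicity would make the logarithm exceed itself.
n<2^[1+⌊log₂n⌋] n = ℕ.≰⇒> λ 2^≤n → ℕ.1+n≰n
  (subst (_≤ ⌊log₂ n ⌋) (⌊log₂[2^n]⌋≡n (suc ⌊log₂ n ⌋)) (⌊log₂⌋-mono-≤ 2^≤n))

corollary3p6 : (G : Graph) → 1 ≤ order G → (d : ℕ) → IsDimEHT G d →
    d ≤ 2 * (dim G + 1) * ⌊log₂ order G ⌋
corollary3p6 G _ d (_ , least) = bound ⌊log₂ order G ⌋ (dim G) refl (n<2^[1+⌊log₂n⌋] (order G))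
  where
  -- The logarithm and the dimension become variables, so that both can be split into cases.
  bound : ∀ l D → dim G ≡ D → order G < 2 ^ suc l → d ≤ 2 * (D + 1) * l
  bound zero    D       _    n<2 =
    subst (d ≤_) (sym (ℕ.*-zeroʳ (2 * (D + 1)))) (least (embeds-0 G (ℕ.≤-pred n<2)))
  bound (suc k) zero    dim≡ _   = ℕ.≤-trans
    (least (placement⇒embeds G (edgeless-placement G (dim≡0⇒edgeless G dim≡))))
    (ℕ.m≤m*n 2 (suc k))
  bound (suc k) (suc D) dim≡ n<  = subst (d ≤_)
    -- Rounds times planes per round times two coordinates per plane.
    (solve 2 (λ k D → (con 1 :+ k) :* (con 2 :+ D) :* con 2
                   := con 2 :* ((con 1 :+ D) :+ con 1) :* (con 1 :+ k)) refl k D)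
    (least (placement⇒embeds G (placement G dim≡ k
      (ℕ.≤-trans (s≤s (∣p∣≤n (⊤ {order G}))) n<))))
    where open ℕ-Solver
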